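{- Let $G$ be a connected graph of order $n$, and let $\mathcal{P}\subseteq\mathcal{L}(G)$ with $|\mathcal{P}|=3$. Then $f(G,\mathcal{P})\leq (n+6)/13$.
   Context: All graphs are finite and simple. For a connected graph $G$, $l(G)$ denotes the length (number of edges) of a longest path in $G$, and $\mathcal{L}(G)$ is the set of paths of $G$ with exactly $l(G)+1$ vertices (the longest paths). $d_G(x,y)$ is the distance between $x$ and $y$ in $G$, and for $U\subseteq V(G)$, $d_G(x,U)=\min\{d_G(x,y)\mid y\in U\}$. For $\mathcal{P}\subseteq\mathcal{L}(G)$, $f(G,\mathcal{P})=\min\{\sum_{P\in\mathcal{P}} d_G(v,V(P))\mid v\in V(G)\}$. -}

module Defs where

open import Data.Nat using (ℕ; zero; suc; _≤_)
open import Data.Fin using (Fin)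
open import Data.Bool using (Bool; true; false)
open import Data.List using (List; []; _∷_; reverse)
open import Data.List.Membership.Propositional using (_∈_)
open import Data.List.Relation.Unary.Linked using (Linked)
open import Data.List.Relation.Unary.Unique.Propositional using (Unique)
open import Data.List using (length)
open import Data.Product using (_×_; ∃-syntax)
open import Data.Sum using (_⊎_)
open import Data.Empty using (⊥)
open import Relation.Binary.PropositionalEquality using (_≡_)

record Graph (n : ℕ) : Set where
  field
    adj    : Fin n → Fin n → Bool
    sym    : ∀ x y → adj x y ≡ adj y x
    irrefl : ∀ x → adj x x ≡ false

module _ {n : ℕ} (G : Graph n) where
  open Graph G

  Adj : Fin n → Fin n → Set
  Adj x y = adj x y ≡ true

  data Walk : Fin n → Fin n → ℕ → Set where
    here : ∀ {x} → Walk x x 0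
    step : ∀ {x y z k} → Adj x y → Walk y z k → Walk x z (suc k)

  Connected : Set
  Connected = ∀ x y → ∃[ k ] Walk x y k

  IsPath : List (Fin n) → Set
  IsPath []      = ⊥
  IsPath (v ∷ vs) = Unique (v ∷ vs) × Linked Adj (v ∷ vs)

  IsLongestPath : List (Fin n) → Set
  IsLongestPath P = IsPath P × (∀ Q → IsPath Q → length Q ≤ length P)

  DistTo : Fin n → List (Fin n) → ℕ → Set
  DistTo x U k = (∃[ y ] (y ∈ U × Walk x y k))
               × (∀ y m → y ∈ U → Walk x y m → k ≤ m)

-- Two vertex sequences describe the same path (subgraph) iff equal or reversed.
SamePath : ∀ {n} → List (Fin n) → List (Fin n) → Set
SamePath P Q = P ≡ Q ⊎ P ≡ reverse Q

{-# OPTIONS --safe #-}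
module Submission where

-- Let L be the common number of vertices of the three longest paths and suppose that the minimum
-- distance sum is g + 1 ≥ 1.  Then no vertex is on all three paths, and a path from a common vertex
-- of two of them to the third one has at least g interior vertices.  Label the vertices of each
-- path by the other paths through them.  Every change of label along a path costs g vertices that
-- are private to it.  If M is a bridge from x on one path to y on another, exchanging ends along M
-- shows that x separates the common vertices of the two paths on the first path, or y does so on
-- the second.  Moreover an ear with m interior vertices on a longest path forces L ≥ 3m + 2.  These
-- two facts give L ≥ 6g + 5 together with at least 8 changes of label in total, unless there is a
-- long ear forcing L ≥ 12g + 11.  As every vertex is on at most two of the paths, 2n is at least 3L
-- plus the number of private vertices, whence n ≥ 13g + 7 in both cases.

open import Defs
open import Data.Bool using (true; false; if_then_else_)
import Data.Bool.Properties as Bool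
open import Data.Empty using (⊥; ⊥-elim)
open import Data.Fin using (Fin)
import Data.Fin.Properties as Fin
open import Data.List using (List; []; _∷_; _++_; _∷ʳ_; length; reverse; filter; allFin)
open import Data.List.Properties
  using (++-assoc; ∷ʳ-++; length-++; length-reverse; length-tabulate; unfold-reverse; reverse-++;
         filter-++; filter-all; ∷-injectiveˡ; ∷-injectiveʳ)
import Data.List.Membership.DecPropositional as DecMembership
open import Data.List.Membership.Propositional using (_∈_; _∉_; find; lose)
open import Data.List.Membership.Propositional.Properties
  using (∈-++⁺ˡ; ∈-++⁺ʳ; ∈-++⁻; ∈-∃++; ∈-filter⁺; ∈-filter⁻; ∈-allFin)
open import Data.List.Relation.Binary.Disjoint.Propositional using (Disjoint)
open import Data.List.Relation.Binary.Sublist.Heterogeneous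
  using (Sublist; []; _∷_; fromAny; toAny; minimum) renaming (_∷ʳ_ to _∷ˢ_)
import Data.List.Relation.Binary.Sublist.Heterogeneous.Properties as Sublist
open import Data.List.Relation.Unary.All as All using ([]; _∷_)
import Data.List.Relation.Unary.All.Properties as All
open import Data.List.Relation.Unary.AllPairs using ([]; _∷_)
open import Data.List.Relation.Unary.Any as Any using (Any; here; there; any?)
open import Data.List.Relation.Unary.Any.Properties using (reverse⁺; reverse⁻)
open import Data.List.Relation.Unary.Linked using (Linked; []; [-]; _∷_)
open import Data.List.Relation.Unary.Unique.Propositional using (Unique)
import Data.List.Relation.Unary.Unique.Propositional.Properties as Unique
open import Data.Nat using (ℕ; zero; suc; _+_; _*_; _≤_; _<_; z≤n; s≤s)
open import Data.Nat.Properties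
  using (≤-refl; ≤-reflexive; ≤-trans; ≤-antisym; <-irrefl; n≤1+n; m≤m+n; m≤n+m;
         +-comm; +-suc; +-mono-≤; +-monoˡ-≤; +-monoʳ-≤; +-cancelˡ-≤; +-cancelʳ-≤;
         *-suc; *-monoˡ-≤; *-monoʳ-≤; *-cancelˡ-≤; module ≤-Reasoning)
  renaming (_≟_ to _≟ℕ_)
open import Data.Nat.Tactic.RingSolver using (solve-∀)
open import Data.Product using (_×_; _,_; proj₁; proj₂; ∃-syntax)
import Data.Product as Product
open import Data.Sum using (_⊎_; inj₁; inj₂) renaming (map to map-⊎; map₂ to map₂-⊎)
open import Relation.Binary.Definitions using (DecidableEquality)
open import Relation.Binary.PropositionalEquality
open import Relation.Nullary using (¬_; contradiction; Dec; yes; no; does)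
open import Relation.Nullary.Decidable using (_×-dec_; ¬?; map′)
open import Relation.Unary using (Decidable)

-- Disjoint, duplicate-free and linked lists; counting and reversal

private
  variable
    A : Set
    x y v : A
    xs ys zs : List A

∈-∷ʳ⁻ : ∀ xs → v ∈ xs ∷ʳ x → v ∈ xs ⊎ v ≡ x
∈-∷ʳ⁻ xs v∈ with ∈-++⁻ xs v∈
... | inj₁ v∈xs      = inj₁ v∈xs
... | inj₂ (here eq) = inj₂ eq

Disjoint-∷ʳ : Disjoint xs ys → x ∉ ys → Disjoint (xs ∷ʳ x) ys
Disjoint-∷ʳ {xs = xs} xs#ys x∉ys (v∈ , v∈ys) with ∈-∷ʳ⁻ xs v∈
... | inj₁ v∈xs = xs#ys (v∈xs , v∈ys)
... | inj₂ refl = x∉ys v∈ys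

Disjoint-∷ : Disjoint xs ys → y ∉ xs → Disjoint xs (y ∷ ys)
Disjoint-∷ xs#ys y∉xs (v∈xs , here refl)  = y∉xs v∈xs
Disjoint-∷ xs#ys y∉xs (v∈xs , there v∈ys) = xs#ys (v∈xs , v∈ys)

Unique-++⁻ : ∀ (xs : List A) → Unique (xs ++ ys) →
             Unique xs × Unique ys × Disjoint xs ys
Unique-++⁻ []       u         = [] , u , λ ()
Unique-++⁻ (x ∷ xs) (x∉ ∷ u) with Unique-++⁻ xs u
... | u₁ , u₂ , xs#ys = All.++⁻ˡ xs x∉ ∷ u₁ , u₂ , disjoint
  where
  disjoint : Disjoint (x ∷ xs) _
  disjoint (here refl  , v∈ys) = All.All¬⇒¬Any (All.++⁻ʳ xs x∉) v∈ys
  disjoint (there v∈xs , v∈ys) = xs#ys (v∈xs , v∈ys)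

Unique-∷ʳ : Unique xs → x ∉ xs → Unique (xs ∷ʳ x)
Unique-∷ʳ u x∉ = Unique.++⁺ u ([] ∷ []) λ { (v∈ , here refl) → x∉ v∈ }

Unique-reverse : Unique xs → Unique (reverse xs)
Unique-reverse {xs = []}     u = u
Unique-reverse {xs = x ∷ xs} u@(_ ∷ u′) = subst Unique (sym (unfold-reverse x xs))
  (Unique-∷ʳ (Unique-reverse u′) (λ x∈ → Unique.Unique[x∷xs]⇒x∉xs u (reverse⁻ x∈)))

module _ {R : A → A → Set} where

  Linked-++⁻ : ∀ xs → Linked R (xs ++ ys) → Linked R xs × Linked R ys
  Linked-++⁻ []           l       = [] , l
  Linked-++⁻ (x ∷ [])     [-]     = [-] , []
  Linked-++⁻ (x ∷ [])     (_ ∷ l) = [-] , l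
  Linked-++⁻ (x ∷ y ∷ xs) (r ∷ l) with Linked-++⁻ (y ∷ xs) l
  ... | l₁ , l₂ = r ∷ l₁ , l₂

  Linked-join : ∀ xs → Linked R (xs ∷ʳ x) → Linked R (x ∷ ys) → Linked R (xs ∷ʳ x ++ ys)
  Linked-join []           _       l = l
  Linked-join (x ∷ [])     (r ∷ _) l = r ∷ l
  Linked-join (x ∷ y ∷ xs) (r ∷ k) l = r ∷ Linked-join (y ∷ xs) k l

  Linked-reverse : (∀ {x y} → R x y → R y x) → Linked R xs → Linked R (reverse xs)
  Linked-reverse R-sym []  = []
  Linked-reverse R-sym [-] = [-]
  Linked-reverse R-sym (_∷_ {x} {y} {xs} r l) = subst (Linked R) (sym eq)
    (Linked-join (reverse xs) (subst (Linked R) (unfold-reverse y xs) (Linked-reverse R-sym l))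
                 (R-sym r ∷ [-]))
    where
    eq : reverse (x ∷ y ∷ xs) ≡ reverse xs ∷ʳ y ++ x ∷ []
    eq = trans (unfold-reverse x (y ∷ xs)) (cong (_∷ʳ x) (unfold-reverse y xs))

length-⊆ : ∀ {ys : List A} → Unique xs → (∀ {v} → v ∈ xs → v ∈ ys) → length xs ≤ length ys
length-⊆ {xs = []}     u ⊆ys = z≤n
length-⊆ {xs = x ∷ xs} u@(_ ∷ u′) ⊆ys with ∈-∃++ (⊆ys (here refl))
... | as , bs , refl = begin
  suc (length xs)               ≤⟨ s≤s (length-⊆ u′ rest) ⟩
  suc (length (as ++ bs))       ≡⟨ cong suc (length-++ as) ⟩
  suc (length as + length bs)   ≡⟨ +-suc (length as) (length bs) ⟨
  length as + suc (length bs)   ≡⟨ length-++ as ⟨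
  length (as ++ x ∷ bs)         ∎
  where
  open ≤-Reasoning
  rest : ∀ {v} → v ∈ xs → v ∈ as ++ bs
  rest v∈ with ∈-++⁻ as (⊆ys (there v∈))
  ... | inj₁ v∈as = ∈-++⁺ˡ v∈as
  ... | inj₂ (here refl) = contradiction v∈ (Unique.Unique[x∷xs]⇒x∉xs u)
  ... | inj₂ (there v∈bs) = ∈-++⁺ʳ as v∈bs

-- Defined through `does`, so that a case split on the three membership decisions of a vertex also
-- evaluates the indicators of composite decisions built from them.
indicator : {P : Set} → Dec P → ℕ
indicator d = if does d then 1 else 0

length-filter-∷ : ∀ {P : A → Set} (P? : Decidable P) x xs →
                  length (filter P? (x ∷ xs)) ≡ indicator (P? x) + length (filter P? xs)
length-filter-∷ P? x xs with does (P? x)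
... | true  = refl
... | false = refl

length-filter-++ : ∀ {P : A → Set} (P? : Decidable P) xs ys →
                   length (filter P? (xs ++ ys)) ≡ length (filter P? xs) + length (filter P? ys)
length-filter-++ P? xs ys = trans (cong length (filter-++ P? xs ys)) (length-++ (filter P? xs))

reverse-∷ʳ : ∀ xs (x : A) → reverse (xs ∷ʳ x) ≡ x ∷ reverse xs
reverse-∷ʳ xs x = reverse-++ xs (x ∷ [])

reverse-mid : ∀ xs (x : A) ys → reverse (xs ++ x ∷ ys) ≡ reverse ys ++ x ∷ reverse xs
reverse-mid xs x ys = trans (reverse-++ xs (x ∷ ys))
  (trans (cong (_++ reverse xs) (unfold-reverse x ys)) (∷ʳ-++ (reverse ys) x (reverse xs)))

reverse-mid₂ : ∀ xs (x : A) ys y zs →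
               reverse (xs ++ x ∷ ys ++ y ∷ zs) ≡ reverse zs ++ y ∷ reverse (xs ++ x ∷ ys)
reverse-mid₂ xs x ys y zs =
  trans (cong reverse (sym (++-assoc xs (x ∷ ys) (y ∷ zs)))) (reverse-mid (xs ++ x ∷ ys) y zs)

-- Paths, bridges and exchange arguments for longest paths

module Paths (A : Set) (R : A → A → Set) (R-sym : ∀ {x y} → R x y → R y x) where

  Path : List A → Set
  Path xs = Unique xs × Linked R xs

  Path-reverse : Path xs → Path (reverse xs)
  Path-reverse (u , l) = Unique-reverse u , Linked-reverse R-sym l

  Path-∷ : R x y → x ∉ y ∷ ys → Path (y ∷ ys) → Path (x ∷ y ∷ ys)
  Path-∷ r x∉ (u , l) = All.¬Any⇒All¬ _ x∉ ∷ u , r ∷ l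

  Path-++⁻ : ∀ xs → Path (xs ++ ys) → Path xs × Path ys
  Path-++⁻ xs (u , l) with Unique-++⁻ xs u | Linked-++⁻ xs l
  ... | u₁ , u₂ , _ | l₁ , l₂ = (u₁ , l₁) , (u₂ , l₂)

  Path-prefix : ∀ xs → Path (xs ++ x ∷ ys) → Path (xs ∷ʳ x)
  Path-prefix {x} {ys} xs p =
    proj₁ (Path-++⁻ (xs ∷ʳ x) (subst Path (sym (∷ʳ-++ xs x ys)) p))

  Path-suffix : ∀ xs → Path (xs ++ x ∷ ys) → Path (x ∷ ys)
  Path-suffix xs p = proj₂ (Path-++⁻ xs p)

  prefix#suffix : ∀ xs → Path (xs ++ x ∷ ys) → Disjoint (xs ∷ʳ x) ys
  prefix#suffix {x} {ys} xs (u , _) =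
    proj₂ (proj₂ (Unique-++⁻ (xs ∷ʳ x) (subst Unique (sym (∷ʳ-++ xs x ys)) u)))

  -- Only the interior `M` is required to be free of repetitions. That it avoids `x` and `y` comes
  -- from its disjointness to the paths containing them.
  Bridge : A → List A → A → Set
  Bridge x M y = Linked R (x ∷ M ∷ʳ y) × Unique M

  Bridge-reverse : ∀ {x M y} → Bridge x M y → Bridge y (reverse M) x
  Bridge-reverse {x} {M} {y} (l , u) = subst (Linked R) eq (Linked-reverse R-sym l) , Unique-reverse u
    where
    eq : reverse (x ∷ M ∷ʳ y) ≡ y ∷ reverse M ∷ʳ x
    eq = trans (unfold-reverse x (M ∷ʳ y)) (cong (_∷ʳ x) (reverse-∷ʳ M y))

  Path⇒Bridge : ∀ xs M {zs} → Path (xs ++ x ∷ M ++ y ∷ zs) → Bridge x M y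
  Path⇒Bridge xs M p =
    proj₂ (Path-prefix (_ ∷ M) (Path-suffix xs p)) ,
    proj₁ (proj₁ (Path-++⁻ M (proj₂ (Path-++⁻ (_ ∷ []) (Path-suffix xs p)))))

  detour : ∀ {a x M y b} → Path (a ∷ʳ x) → Bridge x M y → Path (y ∷ b) →
           Disjoint M (a ∷ʳ x) → Disjoint M (y ∷ b) → Disjoint (a ∷ʳ x) (y ∷ b) →
           Path (a ∷ʳ x ++ M ++ y ∷ b)
  detour {a} {x} {M} {y} {b} (u , l) (lm , um) (u′ , l′) M#a M#b a#b =
    Unique.++⁺ u (Unique.++⁺ um u′ M#b) a#Mb ,
    Linked-join a l (subst (λ zs → Linked R (x ∷ zs)) (∷ʳ-++ M y b) (Linked-join (x ∷ M) lm l′))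
    where
    a#Mb : Disjoint (a ∷ʳ x) (M ++ y ∷ b)
    a#Mb (v∈a , v∈) with ∈-++⁻ M v∈
    ... | inj₁ v∈M = M#a (v∈M , v∈a)
    ... | inj₂ v∈b = a#b (v∈a , v∈b)

  length-detour : ∀ (a : List A) x M y b →
                  length (a ∷ʳ x ++ M ++ y ∷ b) ≡ 2 + (length a + length M + length b)
  length-detour a x M y b
    rewrite length-++ (a ∷ʳ x) {M ++ y ∷ b} | length-++ a {x ∷ []} | length-++ M {y ∷ b}
    = arith (length a) (length M) (length b)
    where
    arith : ∀ a m b → a + 1 + (m + suc b) ≡ 2 + (a + m + b)
    arith = solve-∀

  module Bounded (L : ℕ) (bound : ∀ {xs} → Path xs → length xs ≤ L) where

    Longest : List A → Set
    Longest xs = Path xs × length xs ≡ L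

    detour-bound : ∀ {a x M y b} → Path (a ∷ʳ x) → Bridge x M y → Path (y ∷ b) →
                   Disjoint M (a ∷ʳ x) → Disjoint M (y ∷ b) → Disjoint (a ∷ʳ x) (y ∷ b) →
                   2 + (length a + length M + length b) ≤ L
    detour-bound {a} {x} {M} {y} {b} p br q d₁ d₂ d₃ =
      subst (_≤ L) (length-detour a x M y b) (bound (detour p br q d₁ d₂ d₃))

    -- The ear can replace the stretch N, and it can replace either end of the path when N is
    -- traversed backwards.
    ear-bound : ∀ {ys y N z zs M} → Longest (ys ++ y ∷ N ++ z ∷ zs) → Bridge y M z →
                Disjoint M (ys ++ y ∷ N ++ z ∷ zs) →
                length M ≤ length N × 3 * length M + 2 ≤ L
    ear-bound {ys} {y} {N} {z} {zs} {M} (p , len) br M# =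
      M≤N , ≤-trans (arith M≤N M≤ys M≤zs) (≤-reflexive (sym L≡))
      where
      whole = ys ++ y ∷ N ++ z ∷ zs
      m = length M
      L≡ : L ≡ 2 + (length ys + length N + length zs)
      L≡ = trans (sym len) (trans (cong length (sym (∷ʳ-++ ys y (N ++ z ∷ zs))))
                                  (length-detour ys y N z zs))
      p-y : Path (y ∷ N ++ z ∷ zs)
      p-y = Path-suffix ys p
      p-z : Path (z ∷ zs)
      p-z = Path-suffix (y ∷ N) p-y
      ys#  : Disjoint (ys ∷ʳ y) (N ++ z ∷ zs)
      ys#  = prefix#suffix ys p
      #zs : Disjoint (y ∷ N ∷ʳ z) zs
      #zs = prefix#suffix (y ∷ N) p-y
      yN#z : Disjoint (y ∷ N) (z ∷ zs)
      yN#z = proj₂ (proj₂ (Unique-++⁻ (y ∷ N) (proj₁ p-y)))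
      ys-∈ : v ∈ ys ∷ʳ y → v ∈ whole
      ys-∈ v∈ = subst (_ ∈_) (∷ʳ-++ ys y (N ++ z ∷ zs)) (∈-++⁺ˡ v∈)
      zs-∈ : v ∈ z ∷ zs → v ∈ whole
      zs-∈ v∈ = ∈-++⁺ʳ ys (there (∈-++⁺ʳ N v∈))
      rev-yN : reverse (y ∷ N) ≡ reverse N ∷ʳ y
      rev-yN = unfold-reverse y N
      rev-Nz : reverse (N ∷ʳ z) ≡ z ∷ reverse N
      rev-Nz = reverse-∷ʳ N z
      yN-∈ : v ∈ reverse N ∷ʳ y → v ∈ y ∷ N
      yN-∈ v∈ = reverse⁻ (subst (_ ∈_) (sym rev-yN) v∈)
      Nz-∈ : v ∈ z ∷ reverse N → v ∈ N ∷ʳ z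
      Nz-∈ v∈ = reverse⁻ (subst (_ ∈_) (sym rev-Nz) v∈)
      Nz⊆ : v ∈ N ∷ʳ z → v ∈ N ++ z ∷ zs
      Nz⊆ v∈ = subst (_ ∈_) (∷ʳ-++ N z zs) (∈-++⁺ˡ v∈)
      p-yN : Path (reverse N ∷ʳ y)
      p-yN = subst Path rev-yN (Path-reverse (proj₁ (Path-++⁻ (y ∷ N) p-y)))
      p-Nz : Path (z ∷ reverse N)
      p-Nz = subst Path rev-Nz (Path-reverse (Path-prefix N (proj₂ (Path-++⁻ (y ∷ []) p-y))))
      through : 2 + (length ys + m + length zs) ≤ L
      through = detour-bound (Path-prefix ys p) br p-z
        (λ { (a , b) → M# (a , ys-∈ b) }) (λ { (a , b) → M# (a , zs-∈ b) })
        (λ { (a , b) → ys# (a , ∈-++⁺ʳ N b) })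
      no-ys : 2 + (length N + m + length zs) ≤ L
      no-ys = subst (λ k → 2 + (k + m + length zs) ≤ L) (length-reverse N)
        (detour-bound {a = reverse N} p-yN br p-z
          (λ { (a , b) → M# (a , ∈-++⁺ʳ ys (∈-++⁺ˡ (yN-∈ b))) }) (λ { (a , b) → M# (a , zs-∈ b) })
          (λ { (a , b) → yN#z (yN-∈ a , b) }))
      no-zs : 2 + (length ys + m + length N) ≤ L
      no-zs = subst (λ k → 2 + (length ys + m + k) ≤ L) (length-reverse N)
        (detour-bound {b = reverse N} (Path-prefix ys p) br p-Nz
          (λ { (a , b) → M# (a , ys-∈ b) })
          (λ { (a , b) → M# (a , ∈-++⁺ʳ ys (there (Nz⊆ (Nz-∈ b)))) })
          (λ { (a , b) → ys# (a , Nz⊆ (Nz-∈ b)) }))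
      core : ∀ {k} → 2 + k ≤ L → k ≤ length ys + length N + length zs
      core h = +-cancelˡ-≤ 2 _ _ (≤-trans h (≤-reflexive L≡))
      -- Each exchange inserts `M` and leaves out exactly one of the stretches `N`, `ys`, `zs`, so
      -- `M` is no longer than any of the three. The 2 in the bound stands for `y` and `z`.
      M≤N : m ≤ length N
      M≤N = +-cancelˡ-≤ (length ys) _ _ (+-cancelʳ-≤ (length zs) _ _ (core through))
      M≤ys : m ≤ length ys
      M≤ys = +-cancelˡ-≤ (length N) _ _ (subst (length N + m ≤_) (+-comm (length ys) _)
               (+-cancelʳ-≤ (length zs) _ _ (core no-ys)))
      M≤zs : m ≤ length zs
      M≤zs = +-cancelˡ-≤ (length ys) _ _ (+-cancelʳ-≤ (length N) _ _
               (≤-trans (core no-zs) (≤-reflexive (swap (length ys) (length N) (length zs)))))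
        where
        swap : ∀ a b c → a + b + c ≡ a + c + b
        swap = solve-∀
      arith : ∀ {m a b c} → m ≤ a → m ≤ b → m ≤ c → 3 * m + 2 ≤ 2 + (b + a + c)
      arith {m} {a} {b} {c} h₁ h₂ h₃ = ≤-trans (≤-reflexive (eq m))
        (+-monoʳ-≤ 2 (+-mono-≤ (+-mono-≤ h₂ h₁) h₃))
        where
        eq : ∀ m → 3 * m + 2 ≡ 2 + (m + m + m)
        eq = solve-∀

    -- Otherwise both exchanges of ends along the bridge give paths, with more than 2L vertices
    -- in total.
    crossing : ∀ {xs x xs′ ys y ys′ M} → Longest (xs ++ x ∷ xs′) → Longest (ys ++ y ∷ ys′) →
               Bridge x M y → Disjoint M (xs ++ x ∷ xs′) → Disjoint M (ys ++ y ∷ ys′) →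
               x ∉ ys ++ y ∷ ys′ → y ∉ xs ++ x ∷ xs′ →
               ¬ (Disjoint xs ys′ × Disjoint xs′ ys)
    crossing {xs} {x} {xs′} {ys} {y} {ys′} {M} (p , lp) (q , lq) br M#p M#q x∉q y∉p (d , d′) =
      <-irrefl refl (begin-strict
        L + L                                                   ≡⟨ cong₂ _+_ (len xs lp) (len ys lq) ⟩
        suc (length xs + length xs′) + suc (length ys + length ys′)
          <⟨ arith (length xs) (length xs′) (length ys) (length ys′) (length M) ⟩
        2 + (length xs + length M + length ys′) + (2 + (length ys + length M + length xs′))
          ≤⟨ +-mono-≤ first second ⟩
        L + L ∎)
      where
      open ≤-Reasoning
      len : ∀ as {a bs} → length (as ++ a ∷ bs) ≡ L → L ≡ suc (length as + length bs)
      len as {a} {bs} e = trans (sym e) (trans (length-++ as) (+-suc (length as) (length bs)))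
      incl : ∀ {as a bs} → v ∈ as ∷ʳ a → v ∈ as ++ a ∷ bs
      incl {as = as} {a} {bs} v∈ = subst (_ ∈_) (∷ʳ-++ as a bs) (∈-++⁺ˡ v∈)
      first : 2 + (length xs + length M + length ys′) ≤ L
      first = detour-bound (Path-prefix xs p) br (Path-suffix ys q)
        (λ { (a , b) → M#p (a , incl b) }) (λ { (a , b) → M#q (a , ∈-++⁺ʳ ys b) })
        (Disjoint-∷ (Disjoint-∷ʳ d (λ x∈ → x∉q (∈-++⁺ʳ ys (there x∈)))) (λ y∈ → y∉p (incl y∈)))
      second : 2 + (length ys + length M + length xs′) ≤ L
      second = subst (λ k → 2 + (length ys + k + length xs′) ≤ L) (length-reverse M)
        (detour-bound {M = reverse M} (Path-prefix ys q) (Bridge-reverse br) (Path-suffix xs p)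
          (λ { (a , b) → M#q (reverse⁻ a , incl b) })
          (λ { (a , b) → M#p (reverse⁻ a , ∈-++⁺ʳ xs b) })
          (Disjoint-∷ (Disjoint-∷ʳ (λ { (a , b) → d′ (b , a) }) (λ y∈ → y∉p (∈-++⁺ʳ xs (there y∈))))
                      (λ x∈ → x∉q (incl x∈))))
      arith : ∀ a b c e m → suc (a + b) + suc (c + e) < 2 + (a + m + e) + (2 + (c + m + b))
      arith a b c e m = ≤-trans (m≤m+n _ (1 + m + m)) (≤-reflexive (eq a b c e m))
        where
        eq : ∀ a b c e m → suc (suc (a + b) + suc (c + e)) + (1 + m + m)
                         ≡ 2 + (a + m + e) + (2 + (c + m + b))
        eq = solve-∀

-- Words of labels along a path

Meets : List A → List A → Set
Meets xs U = Any (_∈ U) xs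

split-unique : ∀ (xs : List A) {ys xs′ ys′} → Unique (xs ++ x ∷ ys) →
               xs ++ x ∷ ys ≡ xs′ ++ x ∷ ys′ → xs ≡ xs′ × ys ≡ ys′
split-unique []       {xs′ = []}      u eq = refl , ∷-injectiveʳ eq
split-unique []       {xs′ = z ∷ xs′} u refl =
  contradiction (∈-++⁺ʳ xs′ (here refl)) (Unique.Unique[x∷xs]⇒x∉xs u)
split-unique (z ∷ xs) {xs′ = []}      u refl =
  contradiction (∈-++⁺ʳ xs (here refl)) (Unique.Unique[x∷xs]⇒x∉xs u)
split-unique (z ∷ xs) {xs′ = w ∷ xs′} (_ ∷ u) eq with ∷-injectiveˡ eq | split-unique xs u (∷-injectiveʳ eq)
... | refl | refl , refl = refl , refl

Ordered : A → A → List A → Set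
Ordered x y p = ∃[ xs ] ∃[ N ] ∃[ ys ] p ≡ xs ++ x ∷ N ++ y ∷ ys

order : x ∈ xs → y ∈ xs → x ≢ y → Ordered x y xs ⊎ Ordered y x xs
order (here refl) (here refl) x≢y = contradiction refl x≢y
order (here refl) (there y∈) x≢y with ∈-∃++ y∈
... | N , ys , refl = inj₁ ([] , N , ys , refl)
order (there x∈) (here refl) x≢y with ∈-∃++ x∈
... | N , ys , refl = inj₂ ([] , N , ys , refl)
order {xs = z ∷ _} (there x∈) (there y∈) x≢y =
  map-⊎ cons cons (order x∈ y∈ x≢y)
  where
  cons : ∀ {x y xs} → Ordered x y xs → Ordered x y (z ∷ xs)
  cons (xs , N , ys , eq) = z ∷ xs , N , ys , cong (z ∷_) eq

Ordered⇒≢ : Unique xs → Ordered x y xs → x ≢ y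
Ordered⇒≢ u (xs , N , ys , refl) refl =
  Unique.Unique[x∷xs]⇒x∉xs (proj₁ (proj₂ (Unique-++⁻ xs u))) (∈-++⁺ʳ N (here refl))

-- Vertices of a path are labelled by the other paths through them, so the letters of a word
-- are themselves paths.
Word : List (List A) → List A → Set
Word = Sublist (λ U x → x ∈ U)

Separates : A → List A → List A → Set
Separates x U p = ∃[ l ] ∃[ r ] (p ≡ l ++ x ∷ r × Meets l U × Meets r U)

Separates⇒Word : ∀ {U W p} → x ∈ W → Separates x U p → Word (U ∷ W ∷ U ∷ []) p
Separates⇒Word x∈W (l , r , refl , ml , mr) = Sublist.++⁺ (fromAny ml) (x∈W ∷ fromAny mr)

Word-drop : ∀ {U Us} xs → Disjoint xs U → Word (U ∷ Us) (xs ++ ys) → Word (U ∷ Us) ys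
Word-drop []       d w        = w
Word-drop (x ∷ xs) d (_ ∷ˢ w) = Word-drop xs (λ (a , b) → d (there a , b)) w
Word-drop (x ∷ xs) d (x∈ ∷ w) = contradiction (here refl , x∈) d

-- Scan `p` until one of the two embedded words uses its first letter. The other word still lies
-- entirely behind that vertex, so the letter can be put in front of it. Both cannot start at the
-- same vertex, which would be on all three paths.
Word-alternate : ∀ {q r p : List A} → (∀ {v} → v ∈ p → v ∈ q → v ∈ r → ⊥) →
                 Word (q ∷ r ∷ q ∷ []) p → Word (r ∷ q ∷ r ∷ []) p →
                 Word (q ∷ r ∷ q ∷ r ∷ []) p ⊎ Word (r ∷ q ∷ r ∷ q ∷ []) p
Word-alternate none (y ∷ˢ w) (_ ∷ˢ w′) =
  map-⊎ (y ∷ˢ_) (y ∷ˢ_) (Word-alternate (λ v∈ → none (there v∈)) w w′)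
Word-alternate none (y ∷ˢ w) (y∈ ∷ w′) = inj₂ (y∈ ∷ w)
Word-alternate none (y∈ ∷ w) (_ ∷ˢ w′) = inj₁ (y∈ ∷ w′)
Word-alternate none (y∈q ∷ w) (y∈r ∷ w′) = ⊥-elim (none (here refl) y∈q y∈r)

two-letters : ∀ {q r p : List A} → (∀ {v} → v ∈ p → v ∈ q → v ∈ r → ⊥) →
              Meets p q → Meets p r → Word (q ∷ r ∷ []) p ⊎ Word (r ∷ q ∷ []) p
two-letters none (here y∈q) (here y∈r) = ⊥-elim (none (here refl) y∈q y∈r)
two-letters none (here y∈)  (there m)  = inj₁ (y∈ ∷ fromAny m)
two-letters none (there m)  (here y∈)  = inj₂ (y∈ ∷ fromAny m)
two-letters none (there m)  (there m′) =
  map-⊎ (_ ∷ˢ_) (_ ∷ˢ_) (two-letters (λ v∈ → none (there v∈)) m m′)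

module _ (_≟_ : DecidableEquality A) where
  open DecMembership _≟_ using (_∈?_)

  meets? : ∀ (xs U : List A) → Meets xs U ⊎ Disjoint xs U
  meets? xs U with any? (_∈? U) xs
  ... | yes m = inj₁ m
  ... | no ¬m = inj₂ λ (v∈xs , v∈U) → ¬m (lose v∈xs v∈U)

  first : ∀ {U xs} → Meets xs U → ∃[ l ] ∃[ x ] ∃[ r ] (xs ≡ l ++ x ∷ r × x ∈ U × Disjoint l U)
  first {U} {x ∷ xs} m with x ∈? U
  ... | yes x∈ = [] , x , xs , refl , x∈ , λ ()
  ... | no x∉ with first (Any.tail x∉ m)
  ...   | l , y , r , refl , y∈ , d = x ∷ l , y , r , refl , y∈ ,
          λ { (here refl , v∈U) → x∉ v∈U ; (there v∈l , v∈U) → d (v∈l , v∈U) }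

  last : ∀ {U xs} → Meets xs U → ∃[ l ] ∃[ x ] ∃[ r ] (xs ≡ l ++ x ∷ r × x ∈ U × Disjoint r U)
  last {U} {x ∷ xs} m with meets? xs U | m
  ... | inj₂ d  | here x∈   = [] , x , xs , refl , x∈ , d
  ... | inj₂ d  | there m′ with find m′
  ...   | _ , v∈ , v∈U = contradiction (v∈ , v∈U) d
  last {U} {x ∷ xs} m | inj₁ m′ | _ with last m′
  ... | l , y , r , refl , y∈ , d = x ∷ l , y , r , refl , y∈ , d

  -- The first letter may be matched greedily: nothing before the first vertex of `U` can carry it,
  -- and moving it forward leaves room for the remaining letters.
  uncons : ∀ {U Us} {xs : List A} → Word (U ∷ Us) xs →
           ∃[ l ] ∃[ x ] ∃[ r ] (xs ≡ l ++ x ∷ r × x ∈ U × Disjoint l U × Word Us r)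
  uncons w with first (toAny w)
  ... | l , x , r , refl , x∈ , d = l , x , r , refl , x∈ , d , Sublist.∷⁻ (Word-drop l d w)

  word₃⇒Separates : ∀ {U W p} → Word (U ∷ W ∷ U ∷ []) p → ∃[ x ] (x ∈ W × Separates x U p)
  word₃⇒Separates w with uncons w
  ... | l , c , _ , refl , c∈ , _ , w₁ with uncons w₁
  ...   | l′ , x , r , refl , x∈ , _ , w₂ =
    x , x∈ , l ++ c ∷ l′ , r , sym (++-assoc l (c ∷ l′) (x ∷ r)) ,
    lose (∈-++⁺ʳ l (here refl)) c∈ , toAny w₂

  -- When `p` is a path, the stretch `M` is the interior of a bridge from `q` to `r` that avoids
  -- both.
  Transition : List A → List A → List A → Set
  Transition q r p = ∃[ l ] ∃[ x ] ∃[ M ] ∃[ y ] ∃[ l′ ]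
    (p ≡ l ++ x ∷ M ++ y ∷ l′ × x ∈ q × y ∈ r × Disjoint M q × Disjoint M r)

  LastOn : List A → List A → List A → Set
  LastOn q r xs = ∃[ k ] ∃[ z ] ∃[ M ] (xs ≡ k ++ z ∷ M × z ∈ q × Disjoint M q × Disjoint M r)

  last-on : ∀ {q r x l} → x ∈ q → Disjoint l r → LastOn q r (x ∷ l)
  last-on {x = x} {l} x∈ d with last {xs = x ∷ l} (here x∈)
  ... | [] , z , M , refl , z∈ , e = [] , z , M , refl , z∈ , e , d
  ... | _ ∷ k , z , M , refl , z∈ , e =
    _ ∷ k , z , M , refl , z∈ , e , λ (a , b) → d (∈-++⁺ʳ k (there a) , b)

  -- After the first vertex of `q`, go to the next vertex of `r`, then back to the last vertex of
  -- `q` before it.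
  transition : ∀ {q r p} → Word (q ∷ r ∷ []) p → Transition q r p
  transition {q} {r} w with uncons w
  ... | l , x , _ , refl , x∈ , _ , w₁ with uncons w₁
  ...   | m , y , l′ , refl , y∈ , d , _ with last-on {q} {r} {x} {m} x∈ d
  ...     | k , z , M , eq , z∈ , e₁ , e₂ =
    l ++ k , z , M , y , l′ , assoc , z∈ , y∈ , e₁ , e₂
    where
    assoc : l ++ x ∷ m ++ y ∷ l′ ≡ (l ++ k) ++ z ∷ M ++ y ∷ l′
    assoc = trans (cong (λ zs → l ++ zs ++ y ∷ l′) eq)
      (trans (cong (l ++_) (++-assoc k (z ∷ M) (y ∷ l′))) (sym (++-assoc l k _)))

-- Three longest paths without a common vertex

module Configurations
  {A : Set} (_≟_ : DecidableEquality A)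
  (R : A → A → Set) (R-sym : ∀ {x y} → R x y → R y x)
  (L : ℕ) (bound : ∀ {xs} → Paths.Path A R R-sym xs → length xs ≤ L)
  (g : ℕ)
  where

  open Paths A R R-sym
  open Bounded L bound

  -- The distance sum enters only through `none` and the fields `apart-p`, `apart-q`, `apart-r`: at
  -- a vertex on two of the paths the sum is the distance to the third. A minimum of `g + 1` edges
  -- becomes `g` interior vertices.
  record Config (p q r : List A) : Set where
    field
      longest-p : Longest p
      longest-q : Longest q
      longest-r : Longest r
      meet-pq   : ∃[ v ] (v ∈ p × v ∈ q)
      meet-pr   : ∃[ v ] (v ∈ p × v ∈ r)
      meet-qr   : ∃[ v ] (v ∈ q × v ∈ r)
      none      : ∀ {v} → v ∈ p → v ∈ q → v ∈ r → ⊥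
      apart-p   : ∀ {x y M} → x ∈ q → x ∈ r → y ∈ p → Linked R (x ∷ M ∷ʳ y) → g ≤ length M
      apart-q   : ∀ {x y M} → x ∈ p → x ∈ r → y ∈ q → Linked R (x ∷ M ∷ʳ y) → g ≤ length M
      apart-r   : ∀ {x y M} → x ∈ p → x ∈ q → y ∈ r → Linked R (x ∷ M ∷ʳ y) → g ≤ length M

  -- The two transpositions generate all permutations of the paths, so each later lemma is proved
  -- for one arrangement only.
  swap₁₂ : ∀ {p q r} → Config p q r → Config q p r
  swap₁₂ c = record
    { longest-p = longest-q ; longest-q = longest-p ; longest-r = longest-r
    ; meet-pq = Product.map₂ Product.swap meet-pq ; meet-pr = meet-qr ; meet-qr = meet-pr
    ; none = λ a b → none b a
    ; apart-p = apart-q ; apart-q = apart-p ; apart-r = λ a b → apart-r b a }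
    where open Config c

  swap₂₃ : ∀ {p q r} → Config p q r → Config p r q
  swap₂₃ c = record
    { longest-p = longest-p ; longest-q = longest-r ; longest-r = longest-q
    ; meet-pq = meet-pr ; meet-pr = meet-pq ; meet-qr = Product.map₂ Product.swap meet-qr
    ; none = λ a b c → none a c b
    ; apart-p = λ a b → apart-p b a ; apart-q = apart-r ; apart-r = apart-q }
    where open Config c

  rotate : ∀ {p q r} → Config p q r → Config q r p
  rotate c = swap₂₃ (swap₁₂ c)

  ear-length : ∀ {p x M y} → Longest p → x ∈ p → y ∈ p → x ≢ y → Bridge x M y → Disjoint M p →
               3 * length M + 2 ≤ L
  ear-length {M = M} lp x∈ y∈ x≢y br d with order x∈ y∈ x≢y
  ... | inj₁ (xs , N , ys , refl) = proj₂ (ear-bound {xs} lp br d)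
  ... | inj₂ (xs , N , ys , refl) = subst (λ k → 3 * k + 2 ≤ L) (length-reverse M)
    (proj₂ (ear-bound {xs} lp (Bridge-reverse br) (λ (a , b) → d (reverse⁻ a , b))))

  -- Apply `crossing` to `r` and to its reverse. The first says that `xs` meets `ys′` or `xs′` meets
  -- `ys`, the second that `xs` meets `ys` or `xs′` meets `ys′`. In each of the four combinations
  -- one side of one path meets both sides of the other.
  bridge-separates : ∀ {q r x M y} → Longest q → Longest r → x ∈ q → y ∈ r → x ∉ r → y ∉ q →
    Bridge x M y → Disjoint M q → Disjoint M r → Separates x r q ⊎ Separates y q r
  bridge-separates {q} {r} {x} {M} {y} lq lr x∈ y∈ x∉ y∉ br Mq Mr with ∈-∃++ x∈ | ∈-∃++ y∈
  ... | xs , xs′ , refl | ys , ys′ , refl = combine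
        (crossed (crossing lq lr br Mq Mr x∉ y∉))
        (crossed (crossing lq lr′ br Mq (λ (a , b) → Mr (a , back b)) (λ b → x∉ (back b)) y∉))
    where
    r-rev : reverse (ys ++ y ∷ ys′) ≡ reverse ys′ ++ y ∷ reverse ys
    r-rev = reverse-mid ys y ys′
    lr′ : Longest (reverse ys′ ++ y ∷ reverse ys)
    lr′ = subst Longest r-rev (Path-reverse (proj₁ lr) , trans (length-reverse (ys ++ y ∷ ys′)) (proj₂ lr))
    back : ∀ {v} → v ∈ reverse ys′ ++ y ∷ reverse ys → v ∈ ys ++ y ∷ ys′
    back v∈ = reverse⁻ (subst (_ ∈_) (sym r-rev) v∈)
    crossed : ∀ {as as′ bs bs′ : List A} → ¬ (Disjoint as bs′ × Disjoint as′ bs) →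
              Meets as bs′ ⊎ Meets as′ bs
    crossed {as} {as′} {bs} {bs′} h with meets? _≟_ as bs′ | meets? _≟_ as′ bs
    ... | inj₁ m | _      = inj₁ m
    ... | inj₂ _ | inj₁ m = inj₂ m
    ... | inj₂ d | inj₂ e = contradiction ((λ {v} → d {v}) , (λ {v} → e {v})) h
    flip : ∀ {as bs cs : List A} → (∀ {v} → v ∈ as → v ∈ cs) → Meets as bs → Meets bs cs
    flip f m with find m
    ... | _ , a , b = lose b (f a)
    inl : ∀ {as bs : List A} {a v} → v ∈ as → v ∈ as ++ a ∷ bs
    inl = ∈-++⁺ˡ
    inr : ∀ {as bs : List A} {a v} → v ∈ bs → v ∈ as ++ a ∷ bs
    inr {as} v∈ = ∈-++⁺ʳ as (there v∈)
    combine : Meets xs ys′ ⊎ Meets xs′ ys → Meets xs (reverse ys) ⊎ Meets xs′ (reverse ys′) →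
              Separates x (ys ++ y ∷ ys′) (xs ++ x ∷ xs′) ⊎ Separates y (xs ++ x ∷ xs′) (ys ++ y ∷ ys′)
    combine (inj₁ m) (inj₁ m′) = inj₂ (ys , ys′ , refl , flip inl (Any.map reverse⁻ m′) , flip inl m)
    combine (inj₁ m) (inj₂ m′) =
      inj₁ (xs , xs′ , refl , Any.map (inr {ys}) m , Any.map (λ v∈ → inr {ys} (reverse⁻ v∈)) m′)
    combine (inj₂ m) (inj₁ m′) =
      inj₁ (xs , xs′ , refl , Any.map (λ v∈ → inl (reverse⁻ v∈)) m′ , Any.map inl m)
    combine (inj₂ m) (inj₂ m′) =
      inj₂ (ys , ys′ , refl , flip (inr {xs}) m , flip (inr {xs}) (Any.map reverse⁻ m′))

  -- Since 3L ≤ 2n, this bound already implies the theorem.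
  Big : Set
  Big = 12 * g + 11 ≤ L

  -- Private vertices forced by changes of label

  -- The recursion of `gaps-∷` runs over suffixes of `p`, which need not be longest paths, so it
  -- carries this consequence of `Config` in place of a configuration.
  Sep : List A → List A → List A → Set
  Sep p q r = ∀ {x y M} → x ∈ p → y ∈ p → x ∈ q → y ∈ r → Linked R (x ∷ M ∷ʳ y) → g ≤ length M

  sep : ∀ {p q r} → Config p q r → Sep p q r
  sep c x∈p _ x∈q y∈r = Config.apart-r c x∈p x∈q y∈r

  sep′ : ∀ {p q r} → Config p q r → Sep p r q
  sep′ c = sep (swap₂₃ c)

  -- At least k * g vertices of p lie neither on q nor on r.  Leaving the predicate E open makes
  -- this visibly symmetric in q and r.
  Gaps : ℕ → List A → List A → List A → Set₁
  Gaps k p q r = ∀ {E : A → Set} (E? : Decidable E) → (∀ {v} → v ∉ q → v ∉ r → E v) →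
                 k * g ≤ length (filter E? p)

  Gaps-swap : ∀ {k p q r} → Gaps k p q r → Gaps k p r q
  Gaps-swap h E? f = h E? (λ a b → f b a)

  -- Starts with `r`, so that `q ∷ alternating k q r` has exactly `k` changes of letter.
  alternating : ℕ → List A → List A → List (List A)
  alternating zero    q r = []
  alternating (suc k) q r = r ∷ alternating k r q

  -- Let `y` be the first vertex of `r` in `xs`, and `z` the last vertex of `q` before it. The
  -- stretch `M` between them is private and has at least `g` vertices by `Sep`. The count continues
  -- from `y` with `q` and `r` exchanged; the two parts of the list are counted separately, so no
  -- vertex is used twice.
  gaps-∷ : ∀ k {p q r} → Sep p q r → Sep p r q →
           ∀ x xs → (∀ {v} → v ∈ x ∷ xs → v ∈ p) → Linked R (x ∷ xs) → x ∈ q →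
           Word (alternating k q r) xs → Gaps k (x ∷ xs) q r
  gaps-∷ zero    s s′ x xs ⊆p l x∈ w E? f = z≤n
  gaps-∷ (suc k) {p} {q} {r} s s′ x xs ⊆p l x∈ w E? f with uncons _≟_ w
  ... | m , y , l′ , refl , y∈ , d , w′ with last-on _≟_ {q} {r} {x} {m} x∈ d
  ...   | k′ , z , M , eq , z∈ , e₁ , e₂ = begin
    g + k * g                                                 ≤⟨ +-mono-≤ here-gap rest ⟩
    length (filter E? (x ∷ m)) + length (filter E? (y ∷ l′))  ≡⟨ count-++ (x ∷ m) (y ∷ l′) ⟨
    length (filter E? (x ∷ m ++ y ∷ l′))                      ∎
    where
    open ≤-Reasoning
    whole : x ∷ m ++ y ∷ l′ ≡ k′ ++ z ∷ M ++ y ∷ l′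
    whole = trans (cong (_++ y ∷ l′) eq) (++-assoc k′ (z ∷ M) (y ∷ l′))
    linked : Linked R (z ∷ M ++ y ∷ l′)
    linked = proj₂ (Linked-++⁻ k′ (subst (Linked R) whole l))
    z∈p : z ∈ p
    z∈p = ⊆p (subst (z ∈_) (sym whole) (∈-++⁺ʳ k′ (here refl)))
    y∈p : ∀ {v} → v ∈ y ∷ l′ → v ∈ p
    y∈p v∈ = ⊆p (there (∈-++⁺ʳ m v∈))
    M-long : g ≤ length M
    M-long = s z∈p (y∈p (here refl)) z∈ y∈
      (proj₁ (Linked-++⁻ (z ∷ M ∷ʳ y) (subst (Linked R) (cong (z ∷_) (sym (∷ʳ-++ M y l′))) linked)))
    count-++ = length-filter-++ E?
    M-all : filter E? M ≡ M
    M-all = filter-all E? (All.tabulate (λ v∈ → f (λ a → e₁ (v∈ , a)) (λ a → e₂ (v∈ , a))))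
    rest : k * g ≤ length (filter E? (y ∷ l′))
    rest = gaps-∷ k s′ s y l′ y∈p (proj₂ (Linked-++⁻ (z ∷ M) linked)) y∈ w′
             E? (λ a b → f b a)
    here-gap : g ≤ length (filter E? (x ∷ m))
    here-gap = begin
      g                                                    ≤⟨ M-long ⟩
      length M                                             ≡⟨ cong length M-all ⟨
      length (filter E? M)                                 ≤⟨ m≤n+m _ _ ⟩
      length (filter E? (k′ ∷ʳ z)) + length (filter E? M)  ≡⟨ count-++ (k′ ∷ʳ z) M ⟨
      length (filter E? (k′ ∷ʳ z ++ M))                    ≡⟨ cong (λ zs → length (filter E? zs))
                                                                (trans (∷ʳ-++ k′ z M) (sym eq)) ⟩
      length (filter E? (x ∷ m))                           ∎

  gaps : ∀ k {p q r} → Config p q r → Word (q ∷ alternating k q r) p → Gaps k p q r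
  gaps k {p} {q} {r} c w E? f with uncons _≟_ w
  ... | l , x , xs , refl , x∈ , _ , w′ = begin
    k * g                                               ≤⟨ gaps-∷ k (sep c) (sep′ c) x xs (∈-++⁺ʳ l)
                                                             linked x∈ w′ E? f ⟩
    length (filter E? (x ∷ xs))                         ≤⟨ m≤n+m _ _ ⟩
    length (filter E? l) + length (filter E? (x ∷ xs))  ≡⟨ length-filter-++ E? l (x ∷ xs) ⟨
    length (filter E? (l ++ x ∷ xs))                    ∎
    where
    open ≤-Reasoning
    linked : Linked R (x ∷ xs)
    linked = proj₂ (Path-suffix l (proj₁ (Config.longest-p c)))

  -- Hops of one path over another and the long ears they give

  -- A stretch of `p` that leaves `q` at `c`, visits `r`, and returns to `q` at `c′`: it is an ear
  -- of `q`.
  record Hop (q r p : List A) : Set where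
    field
      {left M right} : List A
      {c c′}         : A
      p≡             : p ≡ left ++ c ∷ M ++ c′ ∷ right
      c∈             : c ∈ q
      c′∈            : c′ ∈ q
      M#q            : Disjoint M q
      M-meets        : Meets M r

    c∈p : c ∈ p
    c∈p = subst (c ∈_) (sym p≡) (∈-++⁺ʳ left (here refl))

    c′∈p : c′ ∈ p
    c′∈p = subst (c′ ∈_) (sym p≡) (∈-++⁺ʳ left (there (∈-++⁺ʳ M (here refl))))

    M⊆p : ∀ {v} → v ∈ M → v ∈ p
    M⊆p v∈ = subst (_ ∈_) (sym p≡) (∈-++⁺ʳ left (there (∈-++⁺ˡ v∈)))

  module _ {p q r : List A} (cfg : Config p q r) where
    open Config cfg

    -- Take the vertices of `q` nearest to `x` on either side along `p`; `x` itself is not on `q`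
    -- because of `none`.
    hop : ∀ {x} → x ∈ r → Separates x q p → Hop q r p
    hop {x} x∈r (l , l′ , refl , ml , ml′) with last _≟_ ml | first _≟_ ml′
    ... | l₁ , c , M₁ , refl , c∈ , d₁ | M₂ , c′ , l₂ , refl , c′∈ , d₂ = record
      { M = M₁ ++ x ∷ M₂
      ; p≡ = trans (++-assoc l₁ (c ∷ M₁) _)
                   (cong (λ zs → l₁ ++ c ∷ zs) (sym (++-assoc M₁ (x ∷ M₂) (c′ ∷ l₂))))
      ; c∈ = c∈ ; c′∈ = c′∈ ; M#q = M#q ; M-meets = lose (∈-++⁺ʳ M₁ (here refl)) x∈r }
      where
      M#q : Disjoint (M₁ ++ x ∷ M₂) q
      M#q (v∈ , v∈q) with ∈-++⁻ M₁ v∈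
      ... | inj₁ v∈M₁ = d₁ (v∈M₁ , v∈q)
      ... | inj₂ (here refl) = none (∈-++⁺ʳ (l₁ ++ c ∷ M₁) (here refl)) v∈q x∈r
      ... | inj₂ (there v∈M₂) = d₂ (v∈M₂ , v∈q)

    module HopProperties (h : Hop q r p) where
      open Hop h

      path : Path (left ++ c ∷ M ++ c′ ∷ right)
      path = subst Path p≡ (proj₁ longest-p)

      bridge : Bridge c M c′
      bridge = Path⇒Bridge left M path

      c≢c′ : c ≢ c′
      c≢c′ = Ordered⇒≢ (proj₁ path) (left , M , right , refl)

      -- A vertex `a` of `r` in `M` is a change of label away from both `c` and `c′`: `g` vertices
      -- on each side, and `a` itself.
      M-long : 2 * g + 1 ≤ length M
      M-long with find M-meets
      ... | a , a∈M , a∈r with ∈-∃++ a∈M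
      ...   | M₁ , M₂ , refl = begin
        2 * g + 1                    ≡⟨ arith g ⟩
        g + suc g                    ≤⟨ +-mono-≤ (long₁ (proj₁ bridge₁)) (s≤s (long₂ (proj₁ bridge₂))) ⟩
        length M₁ + suc (length M₂)  ≡⟨ length-++ M₁ ⟨
        length (M₁ ++ a ∷ M₂)        ∎
        where
        open ≤-Reasoning
        arith : ∀ g → 2 * g + 1 ≡ g + suc g
        arith = solve-∀
        eq : left ++ c ∷ (M₁ ++ a ∷ M₂) ++ c′ ∷ right ≡ left ++ c ∷ M₁ ++ a ∷ M₂ ++ c′ ∷ right
        eq = cong (λ zs → left ++ c ∷ zs) (++-assoc M₁ (a ∷ M₂) (c′ ∷ right))
        bridge₁ : Bridge c M₁ a
        bridge₁ = Path⇒Bridge left M₁ (subst Path eq path)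
        bridge₂ : Bridge a M₂ c′
        bridge₂ = Path⇒Bridge (left ++ c ∷ M₁) M₂
                    (subst Path (trans eq (sym (++-assoc left (c ∷ M₁) _))) path)
        long₁ = sep cfg c∈p (M⊆p a∈M) c∈ a∈r
        long₂ = sep′ cfg (M⊆p a∈M) c′∈p a∈r c′∈

    -- The hop over `r` is an ear of `q` with at least `2 * g + 1` interior vertices, to which the
    -- ear bound applies.
    length-if-Word₃ : Word (q ∷ r ∷ q ∷ []) p → 6 * g + 5 ≤ L
    length-if-Word₃ w with word₃⇒Separates _≟_ w
    ... | x , x∈r , s = begin
      6 * g + 5              ≡⟨ arith g ⟩
      3 * (2 * g + 1) + 2    ≤⟨ +-monoˡ-≤ 2 (*-monoʳ-≤ 3 M-long) ⟩
      3 * length M + 2       ≤⟨ ear-length longest-q c∈ c′∈ c≢c′ bridge M#q ⟩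
      L                      ∎
      where
      open Hop (hop x∈r s)
      open HopProperties (hop x∈r s)
      open ≤-Reasoning
      arith : ∀ g → 6 * g + 5 ≡ 3 * (2 * g + 1) + 2
      arith = solve-∀

    -- If N avoids p, then the stretch of r from the last vertex of p before c to the first one
    -- after c′ is an ear of p, and it contains N, which is at least as long as M.
    long-ear : ∀ {ys c N c′ zs M} → r ≡ ys ++ c ∷ N ++ c′ ∷ zs → c ∈ q → c′ ∈ q →
               Bridge c M c′ → Disjoint M r → 2 * g + 1 ≤ length M →
               Meets ys p → Meets zs p → Meets N p ⊎ Big
    long-ear {ys} {c} {N} {c′} {zs} {M} refl c∈q c′∈q br M#r M-long my mz
      with meets? _≟_ N p | last _≟_ my | first _≟_ mz
    ... | inj₁ m | _ | _ = inj₁ m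
    ... | inj₂ N#p | y₁ , b , y₂ , refl , b∈p , y₂#p | z₁ , b′ , z₂ , refl , b′∈p , z₁#p = inj₂ (begin
      -- The ear `E` has at least `4 * g + 3` interior vertices: `g` before `c`, then `c`, the
      -- `2 * g + 1` of `N`, `c′`, and `g` after it.
      12 * g + 11                                 ≡⟨ arith g ⟩
      3 * (g + suc (2 * g + 1 + suc g)) + 2       ≤⟨ +-monoˡ-≤ 2 (*-monoʳ-≤ 3
          (+-mono-≤ before (s≤s (+-mono-≤ (≤-trans M-long M≤N) (s≤s after))))) ⟩
      3 * (length y₂ + suc (length N + suc (length z₁))) + 2 ≡⟨ cong (λ k → 3 * k + 2) length-E ⟨
      3 * length E + 2                            ≤⟨ ear-length longest-p b∈p b′∈p b≢b′ E-bridge E#p ⟩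
      L                                           ∎)
      where
      open ≤-Reasoning
      arith : ∀ g → 12 * g + 11 ≡ 3 * (g + suc (2 * g + 1 + suc g)) + 2
      arith = solve-∀
      E = y₂ ++ c ∷ N ++ c′ ∷ z₁
      r-path : Path ((y₁ ++ b ∷ y₂) ++ c ∷ N ++ c′ ∷ z₁ ++ b′ ∷ z₂)
      r-path = proj₁ longest-r
      M≤N : length M ≤ length N
      M≤N = proj₁ (ear-bound {y₁ ++ b ∷ y₂} longest-r br M#r)
      length-E : length E ≡ length y₂ + suc (length N + suc (length z₁))
      length-E = trans (length-++ y₂) (cong (λ k → length y₂ + suc k) (length-++ N))
      c∈r : c ∈ r
      c∈r = ∈-++⁺ʳ (y₁ ++ b ∷ y₂) (here refl)
      c′∈r : c′ ∈ r
      c′∈r = ∈-++⁺ʳ (y₁ ++ b ∷ y₂) (there (∈-++⁺ʳ N (here refl)))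
      b∈r : b ∈ r
      b∈r = ∈-++⁺ˡ (∈-++⁺ʳ y₁ (here refl))
      b′∈r : b′ ∈ r
      b′∈r = ∈-++⁺ʳ (y₁ ++ b ∷ y₂) (there (∈-++⁺ʳ N (there (∈-++⁺ʳ z₁ (here refl)))))
      eq₁ : (y₁ ++ b ∷ y₂) ++ c ∷ N ++ c′ ∷ z₁ ++ b′ ∷ z₂ ≡ y₁ ++ b ∷ y₂ ++ c ∷ N ++ c′ ∷ z₁ ++ b′ ∷ z₂
      eq₁ = ++-assoc y₁ (b ∷ y₂) _
      eq₂ : y₂ ++ c ∷ N ++ c′ ∷ z₁ ++ b′ ∷ z₂ ≡ E ++ b′ ∷ z₂
      eq₂ = trans (cong (λ zs → y₂ ++ c ∷ zs) (sym (++-assoc N (c′ ∷ z₁) _)))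
                  (sym (++-assoc y₂ (c ∷ N ++ c′ ∷ z₁) _))
      eq₃ : (y₁ ++ b ∷ y₂) ++ c ∷ N ++ c′ ∷ z₁ ++ b′ ∷ z₂ ≡
            ((y₁ ++ b ∷ y₂) ++ c ∷ N) ++ c′ ∷ z₁ ++ b′ ∷ z₂
      eq₃ = sym (++-assoc (y₁ ++ b ∷ y₂) (c ∷ N) _)
      E-path : Path (y₁ ++ b ∷ E ++ b′ ∷ z₂)
      E-path = subst Path (trans eq₁ (cong (λ zs → y₁ ++ b ∷ zs) eq₂)) r-path
      E-bridge : Bridge b E b′
      E-bridge = Path⇒Bridge y₁ E E-path
      before : g ≤ length y₂
      before = apart (Path⇒Bridge y₁ y₂ (subst Path eq₁ r-path))
        where
        apart : Bridge b y₂ c → g ≤ length y₂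
        apart (l , _) = sep (rotate (rotate cfg)) b∈r c∈r b∈p c∈q l
      after : g ≤ length z₁
      after = apart (Path⇒Bridge ((y₁ ++ b ∷ y₂) ++ c ∷ N) z₁ (subst Path eq₃ r-path))
        where
        apart : Bridge c′ z₁ b′ → g ≤ length z₁
        apart (l , _) = sep′ (rotate (rotate cfg)) c′∈r b′∈r c′∈q b′∈p l
      b≢b′ : b ≢ b′
      b≢b′ = Ordered⇒≢ (proj₁ E-path) (y₁ , E , z₂ , refl)
      E#p : Disjoint E p
      E#p (v∈ , v∈p) with ∈-++⁻ y₂ v∈
      ... | inj₁ v∈y₂ = y₂#p (v∈y₂ , v∈p)
      ... | inj₂ (here refl) = none v∈p c∈q c∈r
      ... | inj₂ (there v∈′) with ∈-++⁻ N v∈′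
      ...   | inj₁ v∈N = N#p (v∈N , v∈p)
      ...   | inj₂ (here refl) = none v∈p c′∈q c′∈r
      ...   | inj₂ (there v∈z₁) = z₁#p (v∈z₁ , v∈p)

    -- Forcing further letters by bridges inside the paths

    p-meets-q : Meets p q
    p-meets-q = lose (proj₁ (proj₂ meet-pq)) (proj₂ (proj₂ meet-pq))

    p-meets-r : Meets p r
    p-meets-r = lose (proj₁ (proj₂ meet-pr)) (proj₂ (proj₂ meet-pr))

    letters : Word (q ∷ r ∷ []) p ⊎ Word (r ∷ q ∷ []) p
    letters = two-letters none p-meets-q p-meets-r

    gaps₁ : Gaps 1 p q r
    gaps₁ with letters
    ... | inj₁ w = gaps 1 cfg w
    ... | inj₂ w = Gaps-swap {1} {p} {r} {q} (gaps 1 (swap₂₃ cfg) w)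

    -- A change of label on `p` is such a bridge; it is reversed if the label `r` comes first, so
    -- that it always leads from `q` to `r`.
    bridge-in : ∃[ x ] ∃[ M ] ∃[ y ] (x ∈ p × x ∈ q × y ∈ p × y ∈ r ×
                                     Bridge x M y × Disjoint M q × Disjoint M r)
    bridge-in with letters
    ... | inj₁ w with transition _≟_ w
    ...   | l , x , M , y , l′ , eq , x∈q , y∈r , M#q , M#r =
      x , M , y , subst (x ∈_) (sym eq) (∈-++⁺ʳ l (here refl)) , x∈q ,
      subst (y ∈_) (sym eq) (∈-++⁺ʳ l (there (∈-++⁺ʳ M (here refl)))) , y∈r ,
      Path⇒Bridge l M (subst Path eq (proj₁ longest-p)) , M#q , M#r
    bridge-in | inj₂ w with transition _≟_ w
    ...   | l , x , M , y , l′ , eq , x∈r , y∈q , M#r , M#q =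
      y , reverse M , x , subst (y ∈_) (sym eq) (∈-++⁺ʳ l (there (∈-++⁺ʳ M (here refl)))) , y∈q ,
      subst (x ∈_) (sym eq) (∈-++⁺ʳ l (here refl)) , x∈r ,
      Bridge-reverse (Path⇒Bridge l M (subst Path eq (proj₁ longest-p))) ,
      (λ (a , b) → M#q (reverse⁻ a , b)) , (λ (a , b) → M#r (reverse⁻ a , b))

    separates : ∀ {x M y} → x ∈ p → x ∈ q → y ∈ p → y ∈ r → Bridge x M y →
                Disjoint M q → Disjoint M r → Separates x r q ⊎ Separates y q r
    separates x∈p x∈q y∈p y∈r =
      bridge-separates longest-q longest-r x∈q y∈r (none x∈p x∈q) (λ y∈q → none y∈p y∈q y∈r)

    -- If `ys` avoids `q`, the whole word `q r q` lies behind `c`; its first two letters preceded by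
    -- `c` give `r q r`.
    outer : ∀ {ys c rest} → Word (q ∷ r ∷ q ∷ []) (ys ++ c ∷ rest) → c ∈ r → c ∉ q →
            Meets ys q ⊎ Word (r ∷ q ∷ r ∷ []) (ys ++ c ∷ rest)
    outer {ys} w c∈r c∉q with meets? _≟_ ys q
    ... | inj₁ m = inj₁ m
    ... | inj₂ d with Word-drop ys d w
    ...   | c∈q ∷ _  = contradiction c∈q c∉q
    ...   | _ ∷ˢ w′ = inj₂ (Sublist.++ˡ ys (c∈r ∷ Sublist.take-Sublist 2 w′))

  -- If r q r does not occur in p, then a bridge in q forces vertices of p around one of q on r;
  -- along p these are enclosed by vertices of q with none between them, so long-ear applies.
  opposite-word : ∀ {p q r} → Config p q r → Word (q ∷ r ∷ q ∷ []) p → Word (r ∷ q ∷ r ∷ []) p ⊎ Big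
  opposite-word {p} {q} {r} cfg w with bridge-in (rotate cfg)
  ... | x , B , y , x∈q , x∈r , y∈q , y∈p , br , B#r , B#p
      with separates (rotate cfg) x∈q x∈r y∈q y∈p br B#r B#p
  ...   | inj₂ s = inj₁ (Separates⇒Word y∈q s)
  ...   | inj₁ s = conclude
    where
    cfg-r : Config r p q
    cfg-r = rotate (rotate cfg)
    open Config cfg
    open Hop (hop cfg-r x∈q s)
    open HopProperties cfg-r (hop cfg-r x∈q s)
    enclosed : ∀ {c c′ M} → Ordered c c′ p → c ∈ p → c ∈ r → c′ ∈ p → c′ ∈ r → Bridge c M c′ →
               Disjoint M p → 2 * g + 1 ≤ length M → Word (r ∷ q ∷ r ∷ []) p ⊎ Big
    enclosed {c} {c′} (ys , N , zs , refl) c∈p c∈r c′∈p c′∈r br M#p long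
      with outer cfg {ys} w c∈r (λ c∈q → none c∈p c∈q c∈r)
         -- The right-hand side is handled by reversing `p`: both three-letter words are
         -- palindromes, so they survive reversal.
         | outer cfg {reverse zs} {c′} (subst (Word (q ∷ r ∷ q ∷ [])) (reverse-mid₂ ys c N c′ zs) (Sublist.reverse⁺ w))
                 c′∈r (λ c∈q → none c′∈p c∈q c′∈r)
    ... | inj₂ w′ | _ = inj₁ w′
    ... | inj₁ _ | inj₂ w′ =
      inj₁ (Sublist.reverse⁻ (subst (Word (r ∷ q ∷ r ∷ [])) (sym (reverse-mid₂ ys c N c′ zs)) w′))
    ... | inj₁ my | inj₁ mz with long-ear (rotate cfg) {ys} {N = N} refl c∈r c′∈r br M#p long my (reverse⁻ mz)
    ...   | inj₂ big = inj₂ big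
    ...   | inj₁ mN = inj₁ (Sublist.++ˡ ys (c∈r ∷ Sublist.++⁺ (fromAny mN) (c′∈r ∷ minimum zs)))
    conclude : Word (r ∷ q ∷ r ∷ []) p ⊎ Big
    conclude with order c∈ c′∈ c≢c′
    ... | inj₁ o = enclosed o c∈ c∈p c′∈ c′∈p bridge M#q M-long
    ... | inj₂ o = enclosed o c′∈ c′∈p c∈ c∈p (Bridge-reverse bridge) (λ (a , b) → M#q (reverse⁻ a , b))
                            (subst (2 * g + 1 ≤_) (sym (length-reverse M)) M-long)

  -- `opposite-word` supplies the other three-letter word, and the two combine to an alternating
  -- word of four letters, that is three changes of label.
  four-letters : ∀ {p q r} → Config p q r →
                 Word (q ∷ r ∷ q ∷ []) p ⊎ Word (r ∷ q ∷ r ∷ []) p → (Gaps 3 p q r × 6 * g + 5 ≤ L) ⊎ Big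
  four-letters {p} {q} {r} cfg (inj₂ w) with four-letters (swap₂₃ cfg) (inj₁ w)
  ... | inj₁ (h , l) = inj₁ (Gaps-swap {3} {p} {r} {q} h , l)
  ... | inj₂ big = inj₂ big
  four-letters {p} {q} {r} cfg (inj₁ w) with opposite-word cfg w
  ... | inj₂ big = inj₂ big
  ... | inj₁ w′ with Word-alternate (Config.none cfg) w w′
  ...   | inj₁ w₄ = inj₁ (gaps 3 cfg w₄ , length-if-Word₃ cfg w)
  ...   | inj₂ w₄ = inj₁ (Gaps-swap {3} {p} {r} {q} (gaps 3 (swap₂₃ cfg) w₄) , length-if-Word₃ cfg w)

  -- The case of a path on which the two labels do not interleave

  module Unsplit {p q r} (cfg : Config p q r)
                 (¬qrq : ¬ Word (q ∷ r ∷ q ∷ []) p) (¬rqr : ¬ Word (r ∷ q ∷ r ∷ []) p) where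
    open Config cfg

    cfg-q : Config q r p
    cfg-q = rotate cfg

    -- A bridge inside `r` from `p` to `q` forces separation at one of its ends. Separation on `p`
    -- would give `q r q` there, so it happens on `q`.
    prp : Word (p ∷ r ∷ p ∷ []) q
    prp with bridge-in (rotate (rotate cfg))
    ... | x , M , y , x∈r , x∈p , y∈r , y∈q , br , M#p , M#q
        with separates (rotate (rotate cfg)) x∈r x∈p y∈r y∈q br M#p M#q
    ...   | inj₁ s = contradiction (Separates⇒Word x∈r s) ¬qrq
    ...   | inj₂ s = Separates⇒Word y∈r s

    gaps-q : (Gaps 3 q p r × 6 * g + 5 ≤ L) ⊎ Big
    gaps-q = four-letters (swap₁₂ cfg) (inj₁ prp)

    -- The alternative from `separates` is that `a` separates `r` on `p`, which is the excluded word
    -- `r q r`.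
    q-separates : ∀ {c M a} → c ∈ q → c ∈ r → a ∈ q → a ∈ p → Bridge c M a →
                  Disjoint M r → Disjoint M p → Separates c p r
    q-separates c∈q c∈r a∈q a∈p br M#r M#p with separates cfg-q c∈q c∈r a∈q a∈p br M#r M#p
    ... | inj₁ s = s
    ... | inj₂ s = contradiction (Separates⇒Word a∈q s) ¬rqr

    -- The separations put vertices of `p` before `c` and after `c′` on `r`, and `long-ear` puts one
    -- between them unless the path is already long enough. `split-unique` identifies the given
    -- decompositions of `r` with the ordered one.
    five-letters : ∀ {c c′ M} → Ordered c c′ r → c ∈ q → c′ ∈ q → Bridge c M c′ → Disjoint M r →
                   2 * g + 1 ≤ length M → Separates c p r → Separates c′ p r →
                   Word (p ∷ q ∷ p ∷ q ∷ p ∷ []) r ⊎ Big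
    five-letters {c} {c′} (ys , N , zs , refl) c∈q c′∈q br M#r long
                 (l₁ , l₂ , eq , m₁ , _) (k₁ , k₂ , eq′ , _ , m₂)
      with split-unique ys (proj₁ (proj₁ longest-r)) eq
         | split-unique (ys ++ c ∷ N) (subst Unique assoc (proj₁ (proj₁ longest-r))) (trans (sym assoc) eq′)
      where
      assoc : ys ++ c ∷ N ++ c′ ∷ zs ≡ (ys ++ c ∷ N) ++ c′ ∷ zs
      assoc = sym (++-assoc ys (c ∷ N) (c′ ∷ zs))
    ... | refl , _ | _ , refl with long-ear cfg {ys} {N = N} refl c∈q c′∈q br M#r long m₁ m₂
    ...   | inj₂ big = inj₂ big
    ...   | inj₁ mN = inj₁ (Sublist.++⁺ (fromAny m₁) (c∈q ∷ Sublist.++⁺ (fromAny mN) (c′∈q ∷ fromAny m₂)))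

    -- On `q`, a hop over `p` leads from `c` to `c′`, both on `r`. The parts of `M` before its first
    -- vertex of `p` and after its last one are bridges, so `q-separates` applies to both `c` and
    -- `c′`.
    gaps-r : Gaps 4 r p q ⊎ Big
    gaps-r with opposite-word (swap₁₂ cfg) prp
    ... | inj₂ big = inj₂ big
    ... | inj₁ rpr with word₃⇒Separates _≟_ rpr
    ...   | x , x∈p , s = conclude
      where
      open Hop (hop cfg-q x∈p s)
      open HopProperties cfg-q (hop cfg-q x∈p s)
      c-separates : Separates c p r
      c-separates with first _≟_ M-meets
      ... | M₁ , a , M₂ , eq , a∈p , M₁#p = q-separates c∈p c∈ a∈q a∈p
        (Path⇒Bridge left M₁ (subst Path assoc path))
        (λ (u , v) → M#q (subst (_ ∈_) (sym eq) (∈-++⁺ˡ u) , v)) M₁#p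
        where
        a∈q = M⊆p (subst (a ∈_) (sym eq) (∈-++⁺ʳ M₁ (here refl)))
        assoc : left ++ c ∷ M ++ c′ ∷ right ≡ left ++ c ∷ M₁ ++ a ∷ M₂ ++ c′ ∷ right
        assoc = cong (λ zs → left ++ c ∷ zs)
          (trans (cong (_++ c′ ∷ right) eq) (++-assoc M₁ (a ∷ M₂) (c′ ∷ right)))
      c′-separates : Separates c′ p r
      c′-separates with last _≟_ M-meets
      ... | M₁ , a , M₂ , eq , a∈p , M₂#p = q-separates c′∈p c′∈ a∈q a∈p
        (Bridge-reverse (Path⇒Bridge (left ++ c ∷ M₁) M₂ (subst Path assoc path)))
        (λ (u , v) → M#q (subst (_ ∈_) (sym eq) (∈-++⁺ʳ M₁ (there (reverse⁻ u))) , v))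
        (λ (u , v) → M₂#p (reverse⁻ u , v))
        where
        a∈q = M⊆p (subst (a ∈_) (sym eq) (∈-++⁺ʳ M₁ (here refl)))
        assoc : left ++ c ∷ M ++ c′ ∷ right ≡ (left ++ c ∷ M₁) ++ a ∷ M₂ ++ c′ ∷ right
        assoc = trans (cong (λ zs → left ++ c ∷ zs)
          (trans (cong (_++ c′ ∷ right) eq) (++-assoc M₁ (a ∷ M₂) (c′ ∷ right))))
          (sym (++-assoc left (c ∷ M₁) _))
      pqpqp : Word (p ∷ q ∷ p ∷ q ∷ p ∷ []) r ⊎ Big
      pqpqp with order c∈ c′∈ c≢c′
      ... | inj₁ o = five-letters o c∈p c′∈p bridge M#q M-long c-separates c′-separates
      ... | inj₂ o = five-letters o c′∈p c∈p (Bridge-reverse bridge) (λ (a , b) → M#q (reverse⁻ a , b))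
                       (subst (2 * g + 1 ≤_) (sym (length-reverse M)) M-long) c′-separates c-separates
      conclude : Gaps 4 r p q ⊎ Big
      conclude with pqpqp
      ... | inj₂ big = inj₂ big
      ... | inj₁ w = inj₁ (gaps 4 (rotate (rotate cfg)) w)

  -- At least eight changes of label in total

  split? : ∀ p q r → (Word (q ∷ r ∷ q ∷ []) p ⊎ Word (r ∷ q ∷ r ∷ []) p) ⊎
                     (¬ Word (q ∷ r ∷ q ∷ []) p × ¬ Word (r ∷ q ∷ r ∷ []) p)
  split? p q r with word? (q ∷ r ∷ q ∷ []) p | word? (r ∷ q ∷ r ∷ []) p
    where
    open DecMembership _≟_ using (_∈?_)
    word? : ∀ Us xs → Dec (Word Us xs)
    word? = Sublist.sublist? (λ U x → x ∈? U)
  ... | yes w | _     = inj₁ (inj₁ w)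
  ... | no _  | yes w = inj₁ (inj₂ w)
  ... | no n₁ | no n₂ = inj₂ (n₁ , n₂)

  Spread : List A → List A → List A → Set₁
  Spread p q r = 6 * g + 5 ≤ L ×
    ∃[ i ] ∃[ j ] ∃[ k ] (8 ≤ i + j + k × Gaps i p q r × Gaps j q r p × Gaps k r p q)

  Spread-rotate : ∀ {p q r} → Spread q r p → Spread p q r
  Spread-rotate (l , i , j , k , h , a , b , c) =
    l , k , i , j , subst (8 ≤_) (arith i j k) h , c , a , b
    where
    arith : ∀ i j k → i + j + k ≡ k + i + j
    arith = solve-∀

  spread-unsplit : ∀ {p q r} → Config p q r →
    ¬ Word (q ∷ r ∷ q ∷ []) p × ¬ Word (r ∷ q ∷ r ∷ []) p → Big ⊎ Spread p q r
  spread-unsplit {p} {q} {r} cfg (n₁ , n₂) with Unsplit.gaps-q cfg n₁ n₂ | Unsplit.gaps-r cfg n₁ n₂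
  ... | inj₂ big | _ = inj₁ big
  ... | inj₁ _ | inj₂ big = inj₁ big
  ... | inj₁ (h₃ , l) | inj₁ h₄ =
    -- One change on the unsplit path, three from the four-letter word on `q`, four from the
    -- five-letter word on `r`: exactly the eight needed.
    inj₂ (l , 1 , 3 , 4 , ≤-refl , gaps₁ cfg , Gaps-swap {3} {q} {p} {r} h₃ , h₄)

  spread : ∀ {p q r} → Config p q r → Big ⊎ Spread p q r
  spread {p} {q} {r} cfg with split? p q r | split? q r p | split? r p q
  ... | inj₂ n | _ | _ = spread-unsplit cfg n
  ... | inj₁ _ | inj₂ n | _ = map₂-⊎ (Spread-rotate {p}) (spread-unsplit (rotate cfg) n)
  ... | inj₁ _ | inj₁ _ | inj₂ n =
    map₂-⊎ (λ s → Spread-rotate {p} (Spread-rotate {q} s)) (spread-unsplit (rotate (rotate cfg)) n)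
  ... | inj₁ s₁ | inj₁ s₂ | inj₁ s₃
      with four-letters cfg s₁ | four-letters (rotate cfg) s₂ | four-letters (rotate (rotate cfg)) s₃
  ...   | inj₂ big | _ | _ = inj₁ big
  ...   | inj₁ _ | inj₂ big | _ = inj₁ big
  ...   | inj₁ _ | inj₁ _ | inj₂ big = inj₁ big
  -- If the labels interleave on all three paths, there are three changes on each, one more than
  -- needed.
  ...   | inj₁ (h₁ , l) | inj₁ (h₂ , _) | inj₁ (h₃ , _) = inj₂ (l , 3 , 3 , 3 , n≤1+n 8 , h₁ , h₂ , h₃)

-- Double counting of the vertices

module _ {n : ℕ} where
  open DecMembership (Fin._≟_ {n}) using (_∈?_)

  Off : List (Fin n) → List (Fin n) → Fin n → Set
  Off U W v = v ∉ U × v ∉ W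

  off? : ∀ U W → Decidable (Off U W)
  off? U W v = ¬? (v ∈? U) ×-dec ¬? (v ∈? W)

module _ {n : ℕ} (p q r : List (Fin n)) (none : ∀ {v} → v ∈ p → v ∈ q → v ∈ r → ⊥) where
  open DecMembership (Fin._≟_ {n}) using (_∈?_)

  private
    only? : ∀ U V W → Decidable (λ v → v ∈ U × Off V W v)
    only? U V W v = v ∈? U ×-dec off? V W v

  counts : List (Fin n) → ℕ
  counts vs = length (filter (_∈? p) vs) + length (filter (_∈? q) vs) + length (filter (_∈? r) vs)
    + (length (filter (only? p q r) vs) + length (filter (only? q r p) vs) + length (filter (only? r p q) vs))

  -- A vertex on two paths contributes 1 for each of them; a vertex on a single path contributes 1
  -- for the path and 1 for being private.
  counts-≤ : ∀ vs → counts vs ≤ 2 * length vs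
  counts-≤ [] = z≤n
  counts-≤ (v ∷ vs)
    rewrite length-filter-∷ (_∈? p) v vs | length-filter-∷ (_∈? q) v vs | length-filter-∷ (_∈? r) v vs
          | length-filter-∷ (only? p q r) v vs | length-filter-∷ (only? q r p) v vs
          | length-filter-∷ (only? r p q) v vs = begin
      _ ≡⟨ regroup (indicator (v ∈? p)) (indicator (v ∈? q)) (indicator (v ∈? r))
             (indicator (only? p q r v)) (indicator (only? q r p v)) (indicator (only? r p q v))
             (length (filter (_∈? p) vs)) (length (filter (_∈? q) vs)) (length (filter (_∈? r) vs)) _ _ _ ⟩
      _ ≤⟨ +-mono-≤ pointwise (counts-≤ vs) ⟩
      2 + 2 * length vs ≡⟨ *-suc 2 (length vs) ⟨
      2 * suc (length vs) ∎
    where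
    open ≤-Reasoning
    regroup : ∀ a b c d e f a′ b′ c′ d′ e′ f′ →
      (a + a′) + (b + b′) + (c + c′) + ((d + d′) + (e + e′) + (f + f′))
      ≡ (a + b + c + (d + e + f)) + (a′ + b′ + c′ + (d′ + e′ + f′))
    regroup = solve-∀
    pointwise : indicator (v ∈? p) + indicator (v ∈? q) + indicator (v ∈? r)
      + (indicator (only? p q r v) + indicator (only? q r p v) + indicator (only? r p q v)) ≤ 2
    pointwise with v ∈? p | v ∈? q | v ∈? r
    ... | yes a | yes b | yes c = ⊥-elim (none a b c)
    ... | yes _ | yes _ | no _  = ≤-refl
    ... | yes _ | no _  | yes _ = ≤-refl
    ... | yes _ | no _  | no _  = ≤-refl
    ... | no _  | yes _ | yes _ = ≤-refl
    ... | no _  | yes _ | no _  = ≤-refl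
    ... | no _  | no _  | yes _ = ≤-refl
    ... | no _  | no _  | no _  = z≤n

  double-count : Unique p → Unique q → Unique r →
    length p + length q + length r
      + (length (filter (off? q r) p) + length (filter (off? r p) q) + length (filter (off? p q) r)) ≤ 2 * n
  double-count up uq ur = begin
    _ ≤⟨ +-mono-≤ (+-mono-≤ (+-mono-≤ (on p up) (on q uq)) (on r ur))
                  (+-mono-≤ (+-mono-≤ (off p q r up) (off q r p uq)) (off r p q ur)) ⟩
    counts (allFin n)       ≤⟨ counts-≤ (allFin n) ⟩
    2 * length (allFin n)   ≡⟨ cong (2 *_) (length-tabulate {n = n} (λ i → i)) ⟩
    2 * n                   ∎
    where
    open ≤-Reasoning
    on : ∀ U → Unique U → length U ≤ length (filter (_∈? U) (allFin n))
    on U u = length-⊆ u (λ v∈ → ∈-filter⁺ (_∈? U) (∈-allFin _) v∈)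
    off : ∀ U V W → Unique U → length (filter (off? V W) U) ≤ length (filter (only? U V W) (allFin n))
    off U V W u = length-⊆ (Unique.filter⁺ (off? V W) u)
      (λ v∈ → ∈-filter⁺ (only? U V W) (∈-allFin _) (∈-filter⁻ (off? V W) v∈))

-- Minima, distances and walks

-- Serves twice: for the distance to a path and for the least distance sum.
least : {P : ℕ → Set} → Decidable P → ∀ m → P m → ∃[ k ] (P k × (∀ m → P m → k ≤ m))
least P? m Pm with P? 0
least P? m       Pm | yes P0 = 0 , P0 , λ _ _ → z≤n
least P? zero    Pm | no ¬P0 = contradiction Pm ¬P0
least P? (suc m) Pm | no ¬P0 with least (λ k → P? (suc k)) m Pm
... | k , Pk , min = suc k , Pk ,
      λ { zero P0 → contradiction P0 ¬P0 ; (suc m) Pm → s≤s (min m Pm) }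

module _ {n : ℕ} (G : Graph n) where
  open Graph G using (adj)
  open DecMembership (Fin._≟_ {n}) using (_∈?_)

  Adj-sym : ∀ {x y} → Adj G x y → Adj G y x
  Adj-sym {x} {y} h = trans (Graph.sym G y x) h

  open Paths (Fin n) (Adj G) Adj-sym

  walk? : ∀ k x y → Dec (Walk G x y k)
  walk? zero x y with x Fin.≟ y
  ... | yes refl = yes here
  ... | no x≢y   = no λ { here → x≢y refl }
  walk? (suc k) x y = map′ (λ (_ , a , w) → step a w) (λ { (step a w) → _ , a , w })
    (Fin.any? (λ z → (adj x z Bool.≟ true) ×-dec walk? k z y))

  distance : Connected G → ∀ v U {u} → u ∈ U → ∃[ k ] DistTo G v U k
  distance conn v U {u} u∈U with conn v u
  ... | m , w with least (λ k → Fin.any? (λ y → (y ∈? U) ×-dec walk? k v y)) m (u , u∈U , w)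
  ...   | k , near , min = k , near , λ y m y∈U w → min m (y , y∈U , w)

  Linked⇒Walk : ∀ M {x y} → Linked (Adj G) (x ∷ M ∷ʳ y) → Walk G x y (suc (length M))
  Linked⇒Walk []      (a ∷ _) = step a here
  Linked⇒Walk (z ∷ M) (a ∷ l) = step a (Linked⇒Walk M l)

  -- The path only has to contain `x` and `y`, which makes the induction short: if `x` is new,
  -- attach it to its neighbour `z` and keep the side of `z` on which `y` lies.
  Walk⇒Path : ∀ {x y k} → Walk G x y k → ∃[ zs ] (Path zs × x ∈ zs × y ∈ zs)
  Walk⇒Path {x} here = x ∷ [] , ([] ∷ [] , [-]) , here refl , here refl
  Walk⇒Path {x} (step {y = z} a w) with Walk⇒Path w
  ... | zs , path , z∈ , y∈ with x ∈? zs | ∈-∃++ z∈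
  ...   | yes x∈ | _ = zs , path , x∈ , y∈
  ...   | no x∉  | as , bs , refl with ∈-++⁻ as y∈
  ...     | inj₂ y∈′  = x ∷ z ∷ bs ,
    Path-∷ a (λ x∈ → x∉ (∈-++⁺ʳ as x∈)) (Path-suffix as path) , here refl , there y∈′
  ...     | inj₁ y∈as = x ∷ z ∷ reverse as ,
    Path-∷ a x∉′ (subst Path (reverse-∷ʳ as z) (Path-reverse (Path-prefix as path))) ,
    here refl , there (there (reverse⁺ y∈as))
    where
    x∉′ : x ∉ z ∷ reverse as
    x∉′ (here refl) = x∉ z∈
    x∉′ (there x∈)  = x∉ (∈-++⁺ˡ (reverse⁻ {xs = as} x∈))

  -- Any two longest paths of a connected graph meet

  module _ (conn : Connected G) (L : ℕ) (bound : ∀ {xs} → Path xs → length xs ≤ L) where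
    open Bounded L bound

    -- Such a path would contain a bridge between `p` and `q`; as these are disjoint, `crossing`
    -- rules it out.
    no-transition : ∀ {p q zs} → Longest p → Longest q → Disjoint p q → Path zs →
                    ¬ Word (p ∷ q ∷ []) zs
    no-transition lp lq d path w with transition Fin._≟_ w
    ... | l , x , M , y , l′ , refl , x∈ , y∈ , M#p , M#q with ∈-∃++ x∈ | ∈-∃++ y∈
    ...   | as , as′ , refl | bs , bs′ , refl =
      crossing lp lq (Path⇒Bridge l M path) M#p M#q (λ b → d (x∈ , b)) (λ a → d (a , y∈))
        ((λ (a , b) → d (∈-++⁺ˡ a , ∈-++⁺ʳ bs (there b))) ,
         (λ (a , b) → d (∈-++⁺ʳ as (there a) , ∈-++⁺ˡ b)))

    -- Were they disjoint, a path through a vertex of each would pass from one to the other.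
    longest-meet : ∀ {p q u w} → Longest p → Longest q → u ∈ p → w ∈ q → ∃[ v ] (v ∈ p × v ∈ q)
    longest-meet {p} {q} {u} {w} lp lq u∈ w∈ with meets? Fin._≟_ p q | Walk⇒Path (proj₂ (conn u w))
    ... | inj₁ m | _ = find m
    ... | inj₂ d | zs , path , u∈zs , w∈zs
        with two-letters (λ _ a b → d (a , b)) (lose u∈zs u∈) (lose w∈zs w∈)
    ...   | inj₁ word = contradiction word (no-transition lp lq d path)
    ...   | inj₂ word = contradiction word (no-transition lq lp (λ (a , b) → d (b , a)) path)

    -- The lower bound on the order

    module _ (g : ℕ) where
      open Configurations Fin._≟_ (Adj G) Adj-sym L bound g

      order-bound : ∀ {p q r} → Config p q r → 13 * g + 7 ≤ n
      order-bound {p} {q} {r} cfg = *-cancelˡ-≤ 2 (≤-trans lower (double-count p q r none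
          (unique longest-p) (unique longest-q) (unique longest-r)))
        where
        open Config cfg
        open ≤-Reasoning
        unique : ∀ {xs} → Longest xs → Unique xs
        unique ((u , _) , _) = u
        total : ℕ
        total = length p + length q + length r
        total≡ : total ≡ 3 * L
        total≡ = trans (cong₂ _+_ (cong₂ _+_ (proj₂ longest-p) (proj₂ longest-q)) (proj₂ longest-r)) (triple L)
          where
          triple : ∀ L → L + L + L ≡ 3 * L
          triple = solve-∀
        lower : 2 * (13 * g + 7) ≤ total + (length (filter (off? q r) p)
                  + length (filter (off? r p) q) + length (filter (off? p q) r))
        lower with spread cfg
        ... | inj₁ big = begin
          2 * (13 * g + 7)                       ≤⟨ m≤m+n _ (10 * g + 19) ⟩
          2 * (13 * g + 7) + (10 * g + 19)       ≡⟨ arith g ⟩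
          3 * (12 * g + 11)                      ≤⟨ *-monoʳ-≤ 3 big ⟩
          3 * L                                  ≡⟨ total≡ ⟨
          total                                  ≤⟨ m≤m+n _ _ ⟩
          _                                      ∎
          where
          arith : ∀ g → 2 * (13 * g + 7) + (10 * g + 19) ≡ 3 * (12 * g + 11)
          arith = solve-∀
        ... | inj₂ (long , i , j , k , 8≤ , gp , gq , gr) = begin
          -- Three paths with at least `6 * g + 5` vertices and eight gaps of `g` give
          -- `26 * g + 15`, one above what is required.
          2 * (13 * g + 7)                       ≤⟨ n≤1+n _ ⟩
          suc (2 * (13 * g + 7))                 ≡⟨ arith g ⟩
          3 * (6 * g + 5) + 8 * g                ≤⟨ +-mono-≤ (*-monoʳ-≤ 3 long) (*-monoˡ-≤ g 8≤) ⟩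
          3 * L + (i + j + k) * g                ≡⟨ cong₂ _+_ (sym total≡) (distrib i j k g) ⟩
          total + (i * g + j * g + k * g)        ≤⟨ +-monoʳ-≤ total (+-mono-≤ (+-mono-≤
                                                      (gp (off? q r) _,_) (gq (off? r p) _,_)) (gr (off? p q) _,_)) ⟩
          _                                      ∎
          where
          arith : ∀ g → suc (2 * (13 * g + 7)) ≡ 3 * (6 * g + 5) + 8 * g
          arith = solve-∀
          distrib : ∀ i j k g → (i + j + k) * g ≡ i * g + j * g + k * g
          distrib = solve-∀

-- From a vertex of least distance sum to the bound

theorem1 : (n : ℕ) (G : Graph n) → Connected G →
    (P₁ P₂ P₃ : List (Fin n)) →
    IsLongestPath G P₁ → IsLongestPath G P₂ → IsLongestPath G P₃ →
    ¬ SamePath P₁ P₂ → ¬ SamePath P₁ P₃ → ¬ SamePath P₂ P₃ →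
    ∃[ v ] ∃[ k₁ ] ∃[ k₂ ] ∃[ k₃ ]
    (DistTo G v P₁ k₁ × DistTo G v P₂ k₂ × DistTo G v P₃ k₃
    × 13 * (k₁ + k₂ + k₃) ≤ n + 6)
theorem1 n G conn [] P₂ P₃ (() , _) _ _ _ _ _
theorem1 n G conn (_ ∷ _) [] P₃ _ (() , _) _ _ _ _
theorem1 n G conn (_ ∷ _) (_ ∷ _) [] _ _ (() , _) _ _ _
theorem1 n G conn P₁@(u₁ ∷ _) P₂@(_ ∷ _) P₃@(_ ∷ _)
         (path₁ , max₁) (path₂ , max₂) (path₃ , max₃) _ _ _ =
  v₀ , _ , _ , _ , proj₂ (d₁ v₀) , proj₂ (d₂ v₀) , proj₂ (d₃ v₀) ,
  subst (λ k → 13 * k ≤ n + 6) (sym total≡) (bound-f f min)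
  where
  open Paths (Fin n) (Adj G) (Adj-sym G)
  L = length P₁
  d₁ = λ v → distance G conn v P₁ (here refl)
  d₂ = λ v → distance G conn v P₂ (here refl)
  d₃ = λ v → distance G conn v P₃ (here refl)
  total : Fin n → ℕ
  total v = proj₁ (d₁ v) + proj₁ (d₂ v) + proj₁ (d₃ v)
  minimiser : ∃[ f ] ((∃[ v ] total v ≡ f) × (∀ m → (∃[ v ] total v ≡ m) → f ≤ m))
  minimiser = least (λ m → Fin.any? (λ v → total v ≟ℕ m)) (total u₁) (u₁ , refl)
  f = proj₁ minimiser
  v₀ = proj₁ (proj₁ (proj₂ minimiser))
  total≡ = proj₂ (proj₁ (proj₂ minimiser))
  min = proj₂ (proj₂ minimiser)

  bound : ∀ {xs} → Path xs → length xs ≤ L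
  -- The empty list satisfies `Path` but not `IsPath`, so maximality does not cover it.
  bound {[]}     _ = z≤n
  bound {x ∷ xs} p = max₁ (x ∷ xs) p
  open Bounded L bound
  longest₁ : Longest P₁
  longest₁ = path₁ , refl
  longest₂ : Longest P₂
  longest₂ = path₂ , ≤-antisym (max₁ P₂ path₂) (max₂ P₁ path₁)
  longest₃ : Longest P₃
  longest₃ = path₃ , ≤-antisym (max₁ P₃ path₃) (max₃ P₁ path₁)

  -- The minimum is generalised to a variable, so that it can be split into 0 and `suc g`; this
  -- fixes the parameter `g` of the configuration.
  bound-f : ∀ f → (∀ m → (∃[ v ] total v ≡ m) → f ≤ m) → 13 * f ≤ n + 6
  bound-f zero    _   = z≤n
  bound-f (suc g) min = begin
    13 * suc g        ≡⟨ arith g ⟩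
    13 * g + 7 + 6    ≤⟨ +-monoˡ-≤ 6 (order-bound G conn L bound g config) ⟩
    n + 6             ∎
    where
    open ≤-Reasoning
    arith : ∀ g → 13 * suc g ≡ 13 * g + 7 + 6
    arith = solve-∀
    far : ∀ {x a b c y₁ y₂ y₃} → y₁ ∈ P₁ → Walk G x y₁ a → y₂ ∈ P₂ → Walk G x y₂ b →
          y₃ ∈ P₃ → Walk G x y₃ c → suc g ≤ a + b + c
    far {x} y₁∈ w₁ y₂∈ w₂ y₃∈ w₃ = ≤-trans (min _ (x , refl))
      (+-mono-≤ (+-mono-≤ (proj₂ (proj₂ (d₁ x)) _ _ y₁∈ w₁) (proj₂ (proj₂ (d₂ x)) _ _ y₂∈ w₂))
                (proj₂ (proj₂ (d₃ x)) _ _ y₃∈ w₃))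
    open Configurations Fin._≟_ (Adj G) (Adj-sym G) L bound g using (Config)
    config : Config P₁ P₂ P₃
    config = record
      { longest-p = longest₁ ; longest-q = longest₂ ; longest-r = longest₃
      ; meet-pq = longest-meet G conn L bound longest₁ longest₂ (here refl) (here refl)
      ; meet-pr = longest-meet G conn L bound longest₁ longest₃ (here refl) (here refl)
      ; meet-qr = longest-meet G conn L bound longest₂ longest₃ (here refl) (here refl)
      -- A vertex on all three paths would have distance sum 0, by three empty walks.
      ; none = λ a b c → contradiction (far a here b here c here) λ ()
      ; apart-p = λ {_} {_} {M} b c y∈ l → near
          (λ m w → subst (suc g ≤_) (arith₁ m) (far y∈ w b here c here)) M l
      ; apart-q = λ {_} {_} {M} a c y∈ l → near
          (λ m w → subst (suc g ≤_) (+-comm m 0) (far a here y∈ w c here)) M l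
      ; apart-r = λ {_} {_} {M} a b y∈ l → near (λ m w → far a here b here y∈ w) M l
      }
      where
      arith₁ : ∀ m → m + 0 + 0 ≡ m
      arith₁ = solve-∀
      near : ∀ {x y} → (∀ m → Walk G x y m → suc g ≤ m) → ∀ M →
             Linked (Adj G) (x ∷ M ∷ʳ y) → g ≤ length M
      near h M l with h _ (Linked⇒Walk G M l)
      ... | s≤s g≤ = g≤
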